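{- (a) The competitive ratio of any deterministic online algorithm for $\mathrm{OMP}_3=\mathrm{OMP}_3(\infty,\infty)$ is at most $\frac23$. (b) The competitive ratio of any deterministic online algorithm for $\mathrm{OMP}_3(\infty,1)$ is at most $\frac35$.
   Context: Online bipartite matching: an instance $(G,\pi)$ is a finite bipartite graph $G=(L,R,E)$ and an arrival order $\pi$ of $R$. The offline side $L$ is known in advance; online vertices $j\in R$ arrive one by one in order $\pi$, and upon arrival of $j$ all edges incident to $j$ are revealed. The algorithm maintains a matching $M$, initially empty. A vertex is free if it is currently unmatched. $\mathrm{OMP}_3(s,t)$ for $s,t\in\mathbb N\cup\{\infty\}$: upon arrival of $j$, the algorithm either leaves $j$ unmatched (forever, unless matched at this moment) or augments the current matching along an augmenting path of length $1$ or $3$ that starts at $j$ and ends at a free vertex of $L$. A length-1 path $[j~i]$ adds $ji$ with $i\in L$ free. A length-3 path $[j~x~y~i]$, with $x,i\in L$, $y\in R$, $xy\in M$, $i$ free, $jx,yi\in E$, replaces $M$ by $(M\setminus\{xy\})\cup\{jx,yi\}$; then $x$ and $y$ are each said to be reassigned once. Over the execution, each vertex of $L$ may be reassigned at most $s$ times and each vertex of $R$ at most $t$ times. A deterministic algorithm may decide arbitrarily (as a function of what has been revealed so far) among the permitted moves, including leaving $j$ unmatched. A deterministic online algorithm $\mathcal A$ is $\rho$-competitive if for every instance $(G,\pi)$ its output matching has size at least $\rho\cdot\nu(G)$, where $\nu(G)$ is the maximum size of a matching in $G$. The competitive ratio of $\mathcal A$ is the largest such $\rho$ (supremum). -}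

module Defs where

open import Data.Fin using (Fin; toℕ)
import Data.Fin.Properties as Fin
open import Data.Fin.Permutation using (Permutation′; _⟨$⟩ʳ_)
open import Data.Fin.Subset using (Subset; _∈_)
open import Data.Integer using (+_)
open import Data.List using (List; []; _∷_; filter; length; map; reverse; tabulate)
import Data.List.Membership.Propositional as List
open import Data.List.Relation.Unary.Unique.Propositional using (Unique)
open import Data.Maybe using (Maybe; just; nothing; Is-just)
import Data.Maybe.Relation.Unary.Any as Maybe
open import Data.Nat using (ℕ; suc; _≤_)
import Data.Nat.Properties as ℕ
open import Data.Product using (∃-syntax; _×_; _,_; proj₁; proj₂)
open import Data.Rational as ℚ using (ℚ; _/_)
open import Data.Unit using (tt)
open import Data.Vec as Vec using (Vec; lookup; replicate; _[_]≔_)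
open import Relation.Binary.Construct.Add.Supremum.NonStrict _≤_ using (_≤⁺_)
open import Relation.Binary.PropositionalEquality using (_≡_)
open import Relation.Nullary.Construct.Add.Supremum using (_⁺; [_])
open import Relation.Nullary.Decidable using (yes)

-- Bipartite graphs with L = Fin n and R = Fin m; the edges are the pairs
-- (i , j) with i ∈ N j.

record BipartiteGraph : Set where
  field
    {n m} : ℕ
    N     : Fin m → Subset n

-- A set of L–R pairs in which each vertex of L occurs at most once,
-- stored as the partial function sending a vertex of L to its partner.

Assignment : ℕ → Set → Set
Assignment n R = Vec (Maybe R) n

module _ {n : ℕ} {R : Set} where

  Matched : Assignment n R → Fin n → R → Set
  Matched M i j = lookup M i ≡ just j

  Free : Assignment n R → Fin n → Set
  Free M i = lookup M i ≡ nothing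

  size : Assignment n R → ℕ
  size = Vec.count (Maybe.dec (λ _ → yes tt))

module _ (G : BipartiteGraph) where
  open BipartiteGraph G

  record IsMatching (M : Assignment n (Fin m)) : Set where
    field
      edge      : ∀ {i j} → Matched M i j → i ∈ N j
      injective : ∀ {i i′ j} → Matched M i j → Matched M i′ j → i ≡ i′

  record IsMatchingNumber (ν : ℕ) : Set where
    field
      attained : ∃[ M ] IsMatching M × size M ≡ ν
      maximal  : ∀ M → IsMatching M → size M ≤ ν

-- During a run the vertices of R are known by names in ℕ, so that the type
-- of what has been revealed does not mention the number of vertices of R.
-- An arrival is the name of an online vertex with its neighbourhood.

Arrival : ℕ → Set
Arrival n = ℕ × Subset n

-- Most recent arrival first.

History : ℕ → Set
History n = List (Arrival n)

-- The options on the arrival of j: leave j unmatched, augment along [j i],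
-- or augment along [j x y i].

data Move (n : ℕ) : Set where
  leave   : Move n
  direct  : (i : Fin n) → Move n
  reroute : (x : Fin n) (y : ℕ) (i : Fin n) → Move n

-- The log has one entry (x , y) for each use of a path [j x y i].

record State (n : ℕ) : Set where
  constructor state
  field
    matching : Assignment n ℕ
    log      : List (Fin n × ℕ)

  reassignedᴸ : Fin n → ℕ
  reassignedᴸ x = length (filter (λ e → proj₁ e Fin.≟ x) log)

  reassignedᴿ : ℕ → ℕ
  reassignedᴿ y = length (filter (λ e → proj₂ e ℕ.≟ y) log)

open State public

start : ∀ {n} → State n
start = state (replicate _ nothing) []

-- In the last clause, overwriting the partner of x also deletes xy.

perform : ∀ {n} → ℕ → Move n → State n → State n
perform j leave           σ           = σ
perform j (direct i)      (state M l) = state (M [ i ]≔ just j) l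
perform j (reroute x y i) (state M l) =
  state ((M [ x ]≔ just j) [ i ]≔ just y) ((x , y) ∷ l)

-- The moves that OMP₃(s,t) permits in state σ, after the arrivals in past,
-- on the arrival of a vertex with neighbourhood Nj.

data Permitted {n} (s t : ℕ ⁺) (past : History n) (σ : State n)
               (Nj : Subset n) : Move n → Set where
  leave   : Permitted s t past σ Nj leave
  direct  : ∀ {i} → i ∈ Nj → Free (matching σ) i →
            Permitted s t past σ Nj (direct i)
  reroute : ∀ {x y i Ny} →
            x ∈ Nj → Matched (matching σ) x y →
            (y , Ny) List.∈ past → i ∈ Ny → Free (matching σ) i →
            [ suc (reassignedᴸ σ x) ] ≤⁺ s →
            [ suc (reassignedᴿ σ y) ] ≤⁺ t →
            Permitted s t past σ Nj (reroute x y i)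

-- The current state need not be an argument of a strategy, since the
-- arrivals and the strategy itself determine it.

Strategy : Set
Strategy = ∀ {n} → (past : History n) (now : Arrival n) → Move n

run : Strategy → ∀ {n} → History n → State n
run decide []           = start
run decide (now ∷ past) =
  perform (proj₁ now) (decide past now) (run decide past)

-- Every history with distinct names is an initial part of some instance.

record OMP₃Algorithm (s t : ℕ ⁺) : Set where
  field
    decide    : Strategy
    permitted : ∀ {n} (past : History n) (now : Arrival n) →
                Unique (map proj₁ (now ∷ past)) →
                Permitted s t past (run decide past) (proj₂ now)
                          (decide past now)

-- π ⟨$⟩ʳ k is the k-th vertex of R to arrive.

module _ (G : BipartiteGraph) where
  open BipartiteGraph G

  arrivals : Permutation′ m → History n
  arrivals π = reverse (tabulate λ k → toℕ (π ⟨$⟩ʳ k) , N (π ⟨$⟩ʳ k))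

module _ {s t : ℕ ⁺} (𝒜 : OMP₃Algorithm s t) where
  open BipartiteGraph
  open OMP₃Algorithm 𝒜

  output : (G : BipartiteGraph) → Permutation′ (m G) → Assignment (n G) ℕ
  output G π = matching (run decide (arrivals G π))

  Competitive : ℚ → Set
  Competitive ρ = ∀ G (π : Permutation′ (m G)) ν → IsMatchingNumber G ν →
                  ρ ℚ.* (+ ν / 1) ℚ.≤ + size (output G π) / 1

  -- The competitive ratio, as a supremum, may be irrational.  It is at most
  -- r exactly when r bounds every ρ for which 𝒜 is ρ-competitive, and
  -- rational ρ suffice because those ρ form a down-closed set.

  CompetitiveRatioAtMost : ℚ → Set
  CompetitiveRatioAtMost r = ∀ ρ → Competitive ρ → ρ ℚ.≤ r

{-# OPTIONS --safe #-}
-- Both bounds come from a finite game in which an adversary reveals online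
-- neighbourhoods one by one, seeing the current state of the algorithm.  If in
-- the end some matching saturates L = Fin n but the algorithm has matched at
-- most k vertices of L, then the ratio is at most k / n.
--
-- For (a), n = 3 and k = 2.  Two arrivals whose neighbourhoods are pairs sharing
-- a matched vertex span a path with both ends in L, one of them free; a third
-- vertex attached to the other end has only an augmenting path of length 5.
-- For (b), n = 5 and k = 3.  The first vertex sees four vertices of L, the second
-- the fifth and two free ones, and the third only the two matched ones.  The
-- third can therefore be matched only by a reroute, after which some y in R is pinned to
-- its partner; two further vertices of degree 1 then find only augmenting paths
-- that are too long or move y again.  Leaving a vertex unmatched only helps the
-- adversary.  The detailed choices are found by a decision procedure.
module Submission where

open import Defs
open import Data.Bool using (true; false)
open import Data.Fin using (Fin; zero; suc; toℕ; fromℕ; inject₁; opposite)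
open import Data.Fin.Permutation using (id)
import Data.Fin.Properties as Fin
open import Data.Fin.Properties using (opposite-involutive; toℕ-fromℕ; toℕ-inject₁)
open import Data.Fin.Subset using (Subset; _∈_; _∉_; _-_; ⁅_⁆; ⊤)
open import Data.Fin.Subset.Properties using (_∈?_; _⊆?_; p─q⊆p)
open import Data.Integer as ℤ using (+_)
import Data.Integer.Properties as ℤ
open import Data.List using (List; []; _∷_; filter; map; allFin; reverse; tabulate; _∷ʳ_; _++_;
  downFrom)
open import Data.List.Properties using (unfold-reverse; tabulate-cong)
open import Data.List.Relation.Unary.All as All using (All)
open import Data.List.Relation.Unary.Any as Any using (Any)
open import Data.List.Relation.Unary.Unique.Propositional using (Unique)
open import Data.List.Relation.Unary.Unique.Propositional.Properties using (downFrom⁺)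
open import Data.Maybe using (just; is-just)
import Data.Maybe.Properties as Maybe
open import Data.Nat using (ℕ; zero; suc; _≤_; _≤?_)
import Data.Nat.Properties as ℕ
open import Data.Product using (∃-syntax; Σ-syntax; _×_; _,_; proj₁; proj₂)
open import Data.Rational as ℚ using (ℚ; _/_)
import Data.Rational.Properties as ℚ
open import Data.Rational.Unnormalised as ℚᵘ using (mkℚᵘ; *≤*)
import Data.Rational.Unnormalised.Properties as ℚᵘ
import Data.Unit as Unit
open import Data.Vec as Vec using (Vec; []; _∷_; lookup; there)
open import Data.Vec.Properties using (lookup∘tabulate; count≤n)
open import Function using (_∘_; const)
open import Relation.Binary.Construct.Add.Supremum.NonStrict _≤_ using (_≤⁺_; ≤⁺-dec)
open import Relation.Binary.PropositionalEquality
open import Relation.Nullary using (Dec; yes; contradiction; _×-dec_; _→-dec_)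
open import Relation.Nullary.Decidable using (toWitness)
open import Relation.Nullary.Construct.Add.Supremum using (_⁺; ⊤⁺; [_])

x∉p-x : ∀ {n} (x : Fin n) p → x ∉ p - x
x∉p-x zero    (true  ∷ p) ()
x∉p-x zero    (false ∷ p) ()
x∉p-x (suc x) (_     ∷ p) (there x∈p-x) = x∉p-x x p x∈p-x

reverse-tabulate : ∀ {A : Set} {n} (f : Fin n → A) →
                   reverse (tabulate f) ≡ tabulate (f ∘ opposite)
reverse-tabulate {n = zero}  f = refl
reverse-tabulate {n = suc n} f = begin
  reverse (f zero ∷ tabulate (f ∘ suc))          ≡⟨ unfold-reverse (f zero) (tabulate (f ∘ suc)) ⟩
  reverse (tabulate (f ∘ suc)) ∷ʳ f zero         ≡⟨ cong (_∷ʳ f zero) (reverse-tabulate (f ∘ suc)) ⟩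
  tabulate (λ k → f (suc (opposite k))) ∷ʳ f zero ≡⟨ snoc f ⟩
  tabulate (f ∘ opposite)                        ∎
  where
  open ≡-Reasoning
  snoc : ∀ {A : Set} {n} (f : Fin (suc n) → A) →
         tabulate (λ k → f (suc (opposite k))) ∷ʳ f zero ≡ tabulate (f ∘ opposite)
  snoc {n = zero}  f = refl
  -- Since `opposite (suc k)` is `inject₁ (opposite k)`, dropping the head leaves the same claim for
  -- `f ∘ inject₁`.
  snoc {n = suc n} f = cong (f (suc (fromℕ n)) ∷_) (snoc (f ∘ inject₁))

size-just : ∀ {A : Set} {n} (g : Fin n → A) → size (Vec.tabulate (just ∘ g)) ≡ n
size-just {n = zero}  g = refl
size-just {n = suc n} g = cong suc (size-just (g ∘ suc))

-- A system of distinct representatives, drawn from S, of the sets P i.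

SDR : ∀ {n m} → (Fin n → Fin m → Set) → Subset m → Set
SDR {zero}  P S = Unit.⊤
SDR {suc n} P S = ∃[ j ] j ∈ S × P zero j × SDR (P ∘ suc) (S - j)

SDR? : ∀ {n m} {P : Fin n → Fin m → Set} → (∀ i j → Dec (P i j)) →
       ∀ S → Dec (SDR P S)
SDR? {zero}  P? S = yes Unit.tt
SDR? {suc n} P? S =
  Fin.any? λ j → j ∈? S ×-dec P? zero j ×-dec SDR? (P? ∘ suc) (S - j)

representatives : ∀ {n m} {P : Fin n → Fin m → Set} {S} → SDR P S →
                  Σ[ g ∈ (Fin n → Fin m) ] (∀ i → g i ∈ S × P i (g i)) ×
                             (∀ {i i′} → g i ≡ g i′ → i ≡ i′)
representatives {zero}  _ = (λ ()) , (λ ()) , λ { {()} }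
representatives {suc n} {P = P} {S} (j , j∈S , Pj , rest)
  with g , g∈ , g-inj ← representatives rest = h , h∈ , h-inj
  where
  h : Fin (suc n) → Fin _
  h zero    = j
  h (suc i) = g i

  h∈ : ∀ i → h i ∈ S × P i (h i)
  h∈ zero    = j∈S , Pj
  h∈ (suc i) = p─q⊆p S ⁅ j ⁆ (proj₁ (g∈ i)) , proj₂ (g∈ i)

  j≢g : ∀ i → j ≢ g i
  j≢g i refl = x∉p-x j S (proj₁ (g∈ i))

  h-inj : ∀ {i i′} → h i ≡ h i′ → i ≡ i′
  h-inj {zero}  {zero}   eq = refl
  h-inj {zero}  {suc i′} eq = contradiction eq (j≢g i′)
  h-inj {suc i} {zero}   eq = contradiction (sym eq) (j≢g i)
  h-inj {suc i} {suc i′} eq = cong suc (g-inj eq)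

module _ {n : ℕ} where

  -- The most recent arrival is the head of the vector and has the largest name.

  history : ∀ {m} → Vec (Subset n) m → History n
  history         []       = []
  history {suc m} (N ∷ Ns) = (m , N) ∷ history Ns

  history-names : ∀ {m} (Ns : Vec (Subset n) m) → map proj₁ (history Ns) ≡ downFrom m
  history-names         []       = refl
  history-names {suc m} (N ∷ Ns) = cong (m ∷_) (history-names Ns)

  history-unique : ∀ {m} (Ns : Vec (Subset n) m) → Unique (map proj₁ (history Ns))
  history-unique Ns = subst Unique (sym (history-names Ns)) (downFrom⁺ _)

  history-tabulate : ∀ {m} (Ns : Vec (Subset n) m) →
                     history Ns ≡ tabulate λ k → toℕ (opposite k) , lookup Ns k
  history-tabulate         []       = refl
  history-tabulate {suc m} (N ∷ Ns) =
    cong₂ _∷_ (cong (_, N) (sym (toℕ-fromℕ m)))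
      (trans (history-tabulate Ns)
             (tabulate-cong λ k → cong (_, lookup Ns k) (sym (toℕ-inject₁ (opposite k)))))

  -- `Ns` lists the latest arrival first, so `opposite` makes vertex `k` of R the `k`-th to arrive
  -- under `id`.
  instanceOf : ∀ {m} → Vec (Subset n) m → BipartiteGraph
  instanceOf Ns = record { N = lookup Ns ∘ opposite }

  arrivals-instanceOf : ∀ {m} (Ns : Vec (Subset n) m) →
                        arrivals (instanceOf Ns) id ≡ history Ns
  arrivals-instanceOf {m} Ns = begin
    reverse (tabulate arrival)                            ≡⟨ reverse-tabulate arrival ⟩
    tabulate (arrival ∘ opposite)                         ≡⟨ tabulate-cong (λ k →
        cong (λ l → toℕ (opposite k) , lookup Ns l) (opposite-involutive k)) ⟩
    (tabulate λ k → toℕ (opposite k) , lookup Ns k)       ≡⟨ history-tabulate Ns ⟨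
    history Ns                                            ∎
    where
    open ≡-Reasoning
    arrival : Fin m → Arrival n
    arrival k = toℕ k , lookup Ns (opposite k)

  Saturating : ∀ {m} → Vec (Subset n) m → Set
  Saturating Ns = SDR (λ i j → i ∈ lookup Ns (opposite j)) ⊤

  saturating⇒matchingNumber : ∀ {m} (Ns : Vec (Subset n) m) → Saturating Ns →
                              IsMatchingNumber (instanceOf Ns) n
  saturating⇒matchingNumber Ns sdr with g , g∈ , g-inj ← representatives sdr = record
    { attained = Vec.tabulate (just ∘ g) , isMatching , size-just g
    ; maximal  = λ M _ → count≤n _ M
    }
    where
    partner : ∀ {i j} → Matched (Vec.tabulate (just ∘ g)) i j → g i ≡ j
    partner {i} eq = Maybe.just-injective (trans (sym (lookup∘tabulate (just ∘ g) i)) eq)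

    isMatching : IsMatching (instanceOf Ns) (Vec.tabulate (just ∘ g))
    isMatching = record
      { edge      = λ {i} eq → subst (λ j → i ∈ lookup Ns (opposite j)) (partner eq) (proj₂ (g∈ i))
      ; injective = λ eq eq′ → g-inj (trans (partner eq) (sym (partner eq′)))
      }

-- The adversary needs only one good choice, so a short list of candidates is sound and keeps the
-- search small.
Menu : ℕ → Set
Menu n = State n → List (Subset n)

module _ (s t : ℕ ⁺) {n : ℕ} where

  -- `Move n` is infinite because `reroute` carries a name in ℕ. Letting `y` range over `past`
  -- instead makes the quantification over permitted moves finite, hence decidable.
  EveryReply : History n → State n → Subset n → (Move n → Set) → Set
  EveryReply past σ N P =
    P leave ×
    (∀ i → i ∈ N → Free (matching σ) i → P (direct i)) ×
    (∀ x → x ∈ N → All (λ (y , Ny) → Matched (matching σ) x y →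
       [ suc (reassignedᴸ σ x) ] ≤⁺ s → [ suc (reassignedᴿ σ y) ] ≤⁺ t →
       ∀ i → i ∈ Ny → Free (matching σ) i → P (reroute x y i)) past)

  everyReply? : ∀ past σ N {P} → (∀ μ → Dec (P μ)) → Dec (EveryReply past σ N P)
  everyReply? past σ N P? =
    P? leave ×-dec
    (Fin.all? λ i → i ∈? N →-dec free? i →-dec P? (direct i)) ×-dec
    (Fin.all? λ x → x ∈? N →-dec All.all? (λ (y , Ny) →
       Maybe.≡-dec ℕ._≟_ _ _ →-dec
       ≤⁺-dec _≤?_ _ s →-dec ≤⁺-dec _≤?_ _ t →-dec
       Fin.all? λ i → i ∈? Ny →-dec free? i →-dec P? (reroute x y i)) past)
    where
    free? : ∀ i → Dec (Free (matching σ) i)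
    free? i = Maybe.≡-dec ℕ._≟_ _ _

  applyReply : ∀ {past σ N P μ} → EveryReply past σ N P → Permitted s t past σ N μ → P μ
  applyReply (p , _ , _) leave                  = p
  applyReply (_ , p , _) (direct i∈N free)      = p _ i∈N free
  applyReply (_ , _ , p) (reroute x∈N xy y∈past i∈Ny free ≤s ≤t) =
    All.lookup (p _ x∈N) y∈past xy ≤s ≤t _ i∈Ny free

  -- The adversary answers the current state with a neighbourhood from the next
  -- menu.  The bound on the size is imposed at every stage only to cut the
  -- search short: sizes never decrease.

  mutual
    Wins : ℕ → List (Menu n) → ∀ {m} → Vec (Subset n) m → State n → Set
    Wins k menus Ns σ = size (matching σ) ≤ k × Continues k menus Ns σ

    Continues : ℕ → List (Menu n) → ∀ {m} → Vec (Subset n) m → State n → Set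
    Continues k []             Ns σ = Saturating Ns
    Continues k (menu ∷ later) {m} Ns σ =
      Any (λ N → EveryReply (history Ns) σ N λ μ → Wins k later (N ∷ Ns) (perform m μ σ)) (menu σ)

  mutual
    wins? : ∀ k menus {m} (Ns : Vec (Subset n) m) σ → Dec (Wins k menus Ns σ)
    wins? k menus Ns σ = size (matching σ) ≤? k ×-dec continues? k menus Ns σ

    continues? : ∀ k menus {m} (Ns : Vec (Subset n) m) σ → Dec (Continues k menus Ns σ)
    continues? k []             Ns σ = SDR? (λ i j → i ∈? lookup Ns (opposite j)) ⊤
    continues? k (menu ∷ later) {m} Ns σ =
      Any.any? (λ N → everyReply? (history Ns) σ N λ μ → wins? k later (N ∷ Ns) (perform m μ σ)) (menu σ)

fromℚᵘ-mono-≤ : ∀ {p q} → p ℚᵘ.≤ q → ℚ.fromℚᵘ p ℚ.≤ ℚ.fromℚᵘ q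
fromℚᵘ-mono-≤ {p} {q} p≤q = ℚ.toℚᵘ-cancel-≤
  (ℚᵘ.≤-respˡ-≃ (ℚᵘ.≃-sym (ℚ.toℚᵘ-fromℚᵘ p))
    (ℚᵘ.≤-respʳ-≃ (ℚᵘ.≃-sym (ℚ.toℚᵘ-fromℚᵘ q)) p≤q))

/1-mono-≤ : ∀ {a b} → a ≤ b → + a / 1 ℚ.≤ + b / 1
/1-mono-≤ {a} {b} a≤b = fromℚᵘ-mono-≤ {mkℚᵘ (+ a) 0} {mkℚᵘ (+ b) 0}
  (*≤* (ℤ.*-monoʳ-≤-nonNeg (+ 1) (ℤ.+≤+ a≤b)))

*-cancel-≤-≡ : ∀ {p q r s} .{{_ : ℚ.Positive r}} → p ℚ.* r ℚ.≤ s → q ℚ.* r ≡ s → p ℚ.≤ q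
*-cancel-≤-≡ {r = r} pr≤s refl = ℚ.*-cancelʳ-≤-pos r pr≤s

module _ {s t : ℕ ⁺} (𝒜 : OMP₃Algorithm s t) where
  open OMP₃Algorithm 𝒜

  -- A deterministic algorithm follows a single branch of the winning tree. Along it the game state
  -- is `run decide` of the history by computation, as the new arrival has name `m` in both.
  wins⇒instance : ∀ {n k} menus {m} (Ns : Vec (Subset n) m) →
                  Wins s t k menus Ns (run decide (history Ns)) →
                  ∃[ m′ ] Σ[ Ns′ ∈ Vec (Subset n) m′ ] Saturating Ns′ ×
                    size (matching (run decide (history Ns′))) ≤ k
  wins⇒instance []             Ns (size≤k , saturating) = _ , Ns , saturating , size≤k
  wins⇒instance (menu ∷ menus) Ns (_ , any) with N , reply ← Any.satisfied any =
    wins⇒instance menus (N ∷ Ns)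
      (applyReply s t {P = λ μ → Wins s t _ menus (N ∷ Ns) (perform _ μ (run decide (history Ns)))}
        reply (permitted (history Ns) (_ , N) (history-unique (N ∷ Ns))))

  wins⇒ratio≤ : ∀ {n k r} .{{_ : ℚ.Positive (+ n / 1)}} menus →
                Wins s t {n} k menus [] start → r ℚ.* (+ n / 1) ≡ + k / 1 →
                CompetitiveRatioAtMost 𝒜 r
  wins⇒ratio≤ {n} {k} menus wins rn≡k ρ competitive =
    let _ , Ns , saturating , size≤k = wins⇒instance menus [] wins
        ρn≤ = competitive (instanceOf Ns) id n (saturating⇒matchingNumber Ns saturating)
        output≤k = subst (λ h → size (matching (run decide h)) ≤ k)
                         (sym (arrivals-instanceOf Ns)) size≤k
    in *-cancel-≤-≡ (ℚ.≤-trans ρn≤ (/1-mono-≤ output≤k)) rn≡k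

pattern I = true
pattern O = false

singletons : ∀ n → List (Subset n)
singletons n = map ⁅_⁆ (allFin n)

pairs : ∀ n → List (Subset n)
pairs zero    = []
pairs (suc n) = map (I ∷_) (singletons n) ++ map (O ∷_) (pairs n)

matchedSet : ∀ {n} → State n → Subset n
matchedSet σ = Vec.map is-just (matching σ)

menus₃ : List (Menu 3)
menus₃ = const (pairs 3) ∷ const (pairs 3) ∷ const (singletons 3) ∷ []

menus₅ : List (Menu 5)
menus₅ =
  const ((I ∷ I ∷ I ∷ I ∷ O ∷ []) ∷ []) ∷
  -- At most one vertex of L is matched by now, so one of the two entries offers two free vertices
  -- besides the fifth.
  const ((I ∷ I ∷ O ∷ O ∷ I ∷ []) ∷ (O ∷ O ∷ I ∷ I ∷ I ∷ []) ∷ []) ∷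
  -- If both earlier arrivals were matched, exactly one pair passes the filter; otherwise several
  -- remain.
  (λ σ → filter (matchedSet σ ⊆?_) (pairs 5)) ∷
  const (singletons 5) ∷ const (singletons 5) ∷ []

theorem18 : ((𝒜 : OMP₃Algorithm ⊤⁺ ⊤⁺) → CompetitiveRatioAtMost 𝒜 (+ 2 / 3)) ×
    ((𝒜 : OMP₃Algorithm ⊤⁺ [ 1 ]) → CompetitiveRatioAtMost 𝒜 (+ 3 / 5))
theorem18 =
  -- Type checking evaluates the game search; `refl` computes `2/3 * 3 = 2`.
  (λ 𝒜 → wins⇒ratio≤ 𝒜 menus₃ (toWitness {a? = wins? _ _ 2 menus₃ [] start} _) refl) ,
  (λ 𝒜 → wins⇒ratio≤ 𝒜 menus₅ (toWitness {a? = wins? _ _ 3 menus₅ [] start} _) refl)
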